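{- An integer $n > 1$ is a Lucas-Carmichael integer if and only if $n$ is square-free and $S_{p+2}(n+2)\equiv 1 \pmod{p+1}$ for every prime divisor $p$ of $n$. That is, $$\mathcal{L}_C=\Big\{ n\in \mathcal{S} : p\mid n \Longrightarrow S_{p+2}(n+2)\equiv 1 \pmod{p+1}\Big\},$$ where $p$ denotes a prime, $\mathcal{L}_C$ denotes the set of all Lucas-Carmichael integers and $\mathcal{S}$ denotes the set of all positive square-free integers.
   Context: A Lucas-Carmichael integer is a square-free positive composite integer $m$ such that $p+1 \mid m+1$ for every prime $p$ dividing $m$. For an integer $b\ge 2$ and a positive integer $N$, $S_b(N)$ denotes the sum of the base-$b$ digits of $N$.
   Formalization: Both the equivalence and the set description are restricted to composite n: every prime n (e.g. n = 2, where S_4(4) = 1) is square-free and satisfies the digit condition, and n = 1 does so vacuously, yet Lucas-Carmichael integers are composite by definition. -}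

module Defs where

open import Data.Digit using (toDigits)
open import Data.Fin.Base using (toℕ)
open import Data.List.Base using (map)
open import Data.Nat.Base using (ℕ; _+_; _*_; _<_; ∣_-_∣; NonTrivial; nonTrivial⇒n>1)
open import Data.Nat.ListAction using (sum)
open import Data.Nat.Divisibility using (_∣_)
open import Data.Nat.Primality using (Prime; Composite)
open import Data.Product.Base using (_×_; proj₁)
open import Level using (0ℓ)
open import Relation.Binary.PropositionalEquality using (_≡_)
open import Relation.Nullary.Decidable using (fromWitness)
open import Relation.Unary using (Pred)

infix 4 _≡_[mod_]

_≡_[mod_] : ℕ → ℕ → ℕ → Set
a ≡ b [mod m ] = m ∣ ∣ a - b ∣

-- `digitSum b N` is S_b(N).  `NonTrivial b` is the library's form of b ≥ 2.
digitSum : (b : ℕ) .{{_ : NonTrivial b}} → ℕ → ℕ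
digitSum b N =
  sum (map toℕ (proj₁ (toDigits b {base≥2 = fromWitness (nonTrivial⇒n>1 b)} N)))

SquareFree : Pred ℕ 0ℓ
SquareFree n = ∀ d → d * d ∣ n → d ≡ 1

𝒮 : Pred ℕ 0ℓ
𝒮 n = 0 < n × SquareFree n

LucasCarmichael : Pred ℕ 0ℓ
LucasCarmichael m =
  0 < m × Composite m × SquareFree m × (∀ p → Prime p → p ∣ m → p + 1 ∣ m + 1)

-- The base p + 2 is written 2 + p so that `NonTrivial (2 + p)` reduces.
--
-- Every prime n satisfies this condition (n + 2 is "10" in base n + 2), and
-- n = 1 satisfies it vacuously, while Lucas-Carmichael integers are composite
-- by definition.  A characterisation of them by this condition therefore has
-- to be restricted to composite n.
DigitCondition : Pred ℕ 0ℓ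
DigitCondition n =
  ∀ p → Prime p → p ∣ n → digitSum (2 + p) (n + 2) ≡ 1 [mod p + 1 ]

{-# OPTIONS --safe #-}
module Submission where

-- Since b ≡ 1 (mod b − 1), every N is congruent to S_b(N) modulo b − 1. With
-- b = p + 2 and N = n + 2 this gives S_{p+2}(n+2) ≡ n + 2 (mod p + 1), so the
-- digit condition at p says exactly that p + 1 divides n + 1.

open import Defs
open import Data.Digit using (Expansion; fromDigits; toDigits)
open import Data.Fin.Base using (toℕ)
open import Data.List.Base using (map; []; _∷_)
open import Data.Nat.Base
  using (ℕ; zero; suc; _+_; _*_; _<_; ∣_-_∣; NonTrivial; nonTrivial⇒n>1)
open import Data.Nat.Divisibility
  using (_∣_; divides; _∣0; n∣m*n; ∣m+n∣m⇒∣n; ∣m∸n∣n⇒∣m)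
open import Data.Nat.ListAction using (sum)
open import Data.Nat.Primality using (Composite)
open import Data.Nat.Properties
open import Data.Product.Base using (_×_; _,_; proj₁; proj₂)
open import Data.Sum.Base using (inj₁; inj₂)
open import Function.Bundles using (_⇔_; mk⇔; Equivalence)
open import Relation.Binary.PropositionalEquality
  using (_≡_; refl; sym; trans; cong; subst)
open import Relation.Nullary.Decidable using (fromWitness)
open import Relation.Unary using (_≐_; _∩_)

private
  variable
    a b c m : ℕ

∣m∣n⇒∣∣m-n∣ : m ∣ a → m ∣ b → m ∣ ∣ a - b ∣
∣m∣n⇒∣∣m-n∣ {m} (divides p refl) (divides q refl) =
  divides ∣ p - q ∣ (sym (*-distribʳ-∣-∣ m p q))

-- Absolute difference is truncated subtraction once the order is known: `b` is `a` plus the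
-- difference when `a ≤ b`, and `a` minus it otherwise.
∣∣m-n∣∣m⇒∣n : m ∣ ∣ a - b ∣ → m ∣ a → m ∣ b
∣∣m-n∣∣m⇒∣n {m} {a} {b} m∣d m∣a with ≤-total a b
... | inj₁ a≤b = ∣m∸n∣n⇒∣m m a≤b (subst (m ∣_) (m≤n⇒∣m-n∣≡n∸m a≤b) m∣d) m∣a
... | inj₂ b≤a = ∣m+n∣m⇒∣n (subst (m ∣_) (sym (m∸n+n≡m b≤a)) m∣a)
  (subst (m ∣_) (trans (∣-∣-comm a b) (m≤n⇒∣m-n∣≡n∸m b≤a)) m∣d)

≡mod-sym : a ≡ b [mod m ] → b ≡ a [mod m ]
≡mod-sym {a} {b} {m} = subst (m ∣_) (∣-∣-comm a b)

-- `∣ suc a - suc b ∣` reduces to `∣ a - b ∣`, so successors are peeled off all three numbers at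
-- once. As soon as one of them is `zero`, each difference with it is the other number itself, and
-- plain divisibility finishes. This avoids a case split on the order of three numbers.
≡mod-trans : a ≡ b [mod m ] → b ≡ c [mod m ] → a ≡ c [mod m ]
≡mod-trans {zero}  {b}     {m} {c}     m∣b m∣bc = ∣∣m-n∣∣m⇒∣n m∣bc m∣b
≡mod-trans {suc a} {zero}  {m} {c}     m∣a m∣c  = ∣m∣n⇒∣∣m-n∣ m∣a m∣c
≡mod-trans {suc a} {suc b} {m} {zero}  m∣ab m∣b =
  ∣∣m-n∣∣m⇒∣n (≡mod-sym {suc a} {suc b} m∣ab) m∣b
≡mod-trans {suc a} {suc b} {m} {suc c} m∣ab m∣bc = ≡mod-trans {a} {b} m∣ab m∣bc

-- Induction on the digits, least significant first. The leading digit cancels from both sides; what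
-- remains is `S ≡ F` by induction, and `F ≡ F * suc m`, whose difference is `F * m`.
sum≡fromDigits : ∀ m (ds : Expansion (suc m)) →
  sum (map toℕ ds) ≡ fromDigits ds [mod m ]
sum≡fromDigits m []       = m ∣0
sum≡fromDigits m (d ∷ ds) =
  subst (m ∣_) (sym (∣m+n-m+o∣≡∣n-o∣ (toℕ d) S (F * suc m)))
    (≡mod-trans {S} {F} (sum≡fromDigits m ds) F≡F*[1+m])
  where
  S = sum (map toℕ ds)
  F = fromDigits ds

  F≡F*[1+m] : F ≡ F * suc m [mod m ]
  F≡F*[1+m] = subst (m ∣_)
    (sym (trans (cong ∣ F -_∣ (*-suc F m)) (∣m-m+n∣≡n F (F * m)))) (n∣m*n F)

digitSum≡ : ∀ m .{{_ : NonTrivial (suc m)}} N → digitSum (suc m) N ≡ N [mod m ]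
digitSum≡ m N =
  subst (λ k → sum (map toℕ (proj₁ e)) ≡ k [mod m ]) (proj₂ e)
    (sum≡fromDigits m (proj₁ e))
  -- The same call as in the body of `digitSum`, so the two agree by unfolding. Its second component
  -- proves that the digits evaluate to `N`.
  where e = toDigits (suc m) {base≥2 = fromWitness (nonTrivial⇒n>1 (suc m))} N

digitSum≡1⇔p+1∣n+1 : ∀ p n →
  digitSum (2 + p) (n + 2) ≡ 1 [mod p + 1 ] ⇔ p + 1 ∣ n + 1
digitSum≡1⇔p+1∣n+1 p n = mk⇔
  -- The chain is `n + 2 ≡ S ≡ 1`, read as divisibility of `n + 2 - 1`.
  (λ S≡1 → subst (p + 1 ∣_) n+2-1
    (≡mod-trans {n + 2} {S} (≡mod-sym {S} {n + 2} S≡n+2) S≡1))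
  (λ p+1∣n+1 → ≡mod-trans {S} {n + 2} S≡n+2
    (subst (p + 1 ∣_) (sym n+2-1) p+1∣n+1))
  where
  S = digitSum (2 + p) (n + 2)

  S≡n+2 : S ≡ n + 2 [mod p + 1 ]
  -- The base is `suc (suc p)`, so the modulus arrives as `1 + p` and has to be commuted.
  S≡n+2 = subst (S ≡ n + 2 [mod_]) (+-comm 1 p) (digitSum≡ (suc p) (n + 2))

  n+2-1 : ∣ n + 2 - 1 ∣ ≡ n + 1
  n+2-1 = trans (cong ∣_- 1 ∣ (+-suc n 1)) (∣-∣-identityʳ (n + 1))

LucasCarmichael⇒DigitCondition : ∀ {n} → LucasCarmichael n → DigitCondition n
LucasCarmichael⇒DigitCondition {n} (_ , _ , _ , p+1∣n+1) p pp p∣n =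
  Equivalence.from (digitSum≡1⇔p+1∣n+1 p n) (p+1∣n+1 p pp p∣n)

DigitCondition⇒LucasCarmichael : ∀ {n} → 0 < n → Composite n → SquareFree n →
  DigitCondition n → LucasCarmichael n
DigitCondition⇒LucasCarmichael {n} 0<n cn sf dc =
  0<n , cn , sf , λ p pp p∣n → Equivalence.to (digitSum≡1⇔p+1∣n+1 p n) (dc p pp p∣n)

proposition3p1 : (∀ n → 1 < n → Composite n →
    LucasCarmichael n ⇔ (SquareFree n × DigitCondition n))
    × (LucasCarmichael ≐ (Composite ∩ 𝒮 ∩ DigitCondition))
proposition3p1 =
  (λ n 1<n cn → mk⇔
    (λ lc@(_ , _ , sf , _) → sf , LucasCarmichael⇒DigitCondition lc)
    -- `1 < n` unfolds to `2 ≤ n`, and the weakened `1 ≤ n` is `0 < n` by definition.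
    (λ (sf , dc) → DigitCondition⇒LucasCarmichael (<⇒≤ 1<n) cn sf dc))
  , (λ lc@(0<n , cn , sf , _) → cn , (0<n , sf) , LucasCarmichael⇒DigitCondition lc)
  , (λ (cn , (0<n , sf) , dc) → DigitCondition⇒LucasCarmichael 0<n cn sf dc)
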